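{- Let $S$ be a set and let $M, I, J, K : S\to S$ be operators. For operators $P,Q$ on $S$ write $PQ$ for the operator that applies $P$ first and then $Q$, and write $1$ for the identity operator. Assume (0) $MM=1$; (1) $II=M$, $JJ=M$, $KK=M$; (2) $IJ=K$; (3) $M$ commutes with each of $I$, $J$, $K$. Then the quaternion relations hold, with $M$ playing the role of $-1$: $$II=JJ=KK=IJK=M,$$ $$IJ=K,\quad JK=I,\quad KI=J,$$ $$JI=KM,\quad KJ=IM,\quad IK=JM.$$
   Context: In the paper, $M$ is the Laws of Form mark acting by enclosure (satisfying the law that enclosing twice gives back the original expression), and $I,J,K$ are three additional "imaginary" marks acting by enclosure. The relations in the conclusion are the defining multiplication rules of the quaternion group $Q_8=\{\pm1,\pm i,\pm j,\pm k\}$, namely $i^2=j^2=k^2=ijk=-1$, $ij=k$, $jk=i$, $ki=j$, $ji=-k$, $kj=-i$, $ik=-j$. -}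

module Defs where

open import Level using (Level)
open import Function.Base using (_∘_)

infixl 9 _⨾_

-- Operators are composed in diagrammatic order: P ⨾ Q applies P first, then Q.
_⨾_ : ∀ {a : Level} {S : Set a} → (S → S) → (S → S) → (S → S)
P ⨾ Q = Q ∘ P

{-# OPTIONS --safe #-}
-- M is an involution, so every square root of M has order dividing 4 and is
-- cancellable on both sides.  Since IJ = K, the product IJK equals KK = M;
-- cancelling I from I(JK) = II gives JK = I, and cancelling J from
-- (KI)J = K(IJ) = JJ gives KI = J.  The remaining relations follow by
-- substituting these into the squares.
module Submission where

open import Level using (Level)
open import Data.Product.Base using (_×_; _,_)
open import Function.Base using (id)
open import Relation.Binary.PropositionalEquality
  using (_≗_; sym; trans; cong; module ≡-Reasoning)
open import Defs

module _ {a : Level} {S : Set a} {M P : S → S}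
         (MM≗id : M ⨾ M ≗ id) (PP≗M : P ⨾ P ≗ M) where

  open ≡-Reasoning

  fourth-power : P ⨾ P ⨾ P ⨾ P ≗ id
  fourth-power x = begin
    P (P (P (P x))) ≡⟨ PP≗M (P (P x)) ⟩
    M (P (P x))     ≡⟨ cong M (PP≗M x) ⟩
    M (M x)         ≡⟨ MM≗id x ⟩
    x               ∎

  -- The cube of `P` inverts `P`; instantiating the hypothesis at the cube of `x` composes it in
  -- front of both sides.
  ⨾-cancelˡ : ∀ {F G : S → S} → P ⨾ F ≗ P ⨾ G → F ≗ G
  ⨾-cancelˡ {F} {G} PF≗PG x = begin
    F x                 ≡⟨ cong F (fourth-power x) ⟨
    F (P (P (P (P x)))) ≡⟨ PF≗PG (P (P (P x))) ⟩
    G (P (P (P (P x)))) ≡⟨ cong G (fourth-power x) ⟩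
    G x                 ∎

  ⨾-cancelʳ : ∀ {F G : S → S} → F ⨾ P ≗ G ⨾ P → F ≗ G
  ⨾-cancelʳ {F} {G} FP≗GP x = begin
    F x                 ≡⟨ fourth-power (F x) ⟨
    -- Dually, the inverse is applied after both sides.
    P (P (P (P (F x)))) ≡⟨ cong (P ⨾ P ⨾ P) (FP≗GP x) ⟩
    P (P (P (P (G x)))) ≡⟨ fourth-power (G x) ⟩
    G x                 ∎

mainTheorem2 : ∀ {a : Level} (S : Set a) (M I J K : S → S) →
    M ⨾ M ≗ id →
    I ⨾ I ≗ M → J ⨾ J ≗ M → K ⨾ K ≗ M →
    I ⨾ J ≗ K →
    M ⨾ I ≗ I ⨾ M → M ⨾ J ≗ J ⨾ M → M ⨾ K ≗ K ⨾ M →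
    (I ⨾ I ≗ J ⨾ J × J ⨾ J ≗ K ⨾ K × K ⨾ K ≗ I ⨾ J ⨾ K × I ⨾ J ⨾ K ≗ M) ×
    (I ⨾ J ≗ K × J ⨾ K ≗ I × K ⨾ I ≗ J) ×
    (J ⨾ I ≗ K ⨾ M × K ⨾ J ≗ I ⨾ M × I ⨾ K ≗ J ⨾ M)
mainTheorem2 S M I J K MM≗id II≗M JJ≗M KK≗M IJ≗K _ _ _ =
  ( (λ x → trans (II≗M x) (sym (JJ≗M x)))
  , (λ x → trans (JJ≗M x) (sym (KK≗M x)))
  , (λ x → cong K (sym (IJ≗K x)))
  , IJK≗M ) ,
  (IJ≗K , JK≗I , KI≗J) ,
  -- Expanding the first factor creates a trailing square: `J ⨾ I` becomes `K ⨾ I ⨾ I`, hence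
  -- `K ⨾ M`; the other two are its cyclic shifts.
  ( (λ x → trans (cong I (sym (KI≗J x))) (II≗M (K x)))
  , (λ x → trans (cong J (sym (IJ≗K x))) (JJ≗M (I x)))
  , (λ x → trans (cong K (sym (JK≗I x))) (KK≗M (J x))) )
  where
  IJK≗M : I ⨾ J ⨾ K ≗ M
  IJK≗M x = trans (cong K (IJ≗K x)) (KK≗M x)

  JK≗I : J ⨾ K ≗ I
  -- `I ⨾ J ⨾ K` serves as `I ⨾ (J ⨾ K)` because `⨾` is associative definitionally.
  JK≗I = ⨾-cancelˡ {P = I} MM≗id II≗M λ x → trans (IJK≗M x) (sym (II≗M x))

  KI≗J : K ⨾ I ≗ J
  KI≗J = ⨾-cancelʳ {P = J} MM≗id JJ≗M λ x →
    trans (IJ≗K (K x)) (trans (KK≗M x) (sym (JJ≗M x)))
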